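{- Let $g,f\in\mathcal{F}_0$. The Riordan array with general $(n,k)$-element $$t_{n,k}=[x^{n-k}]\,g(x)f(x)^n$$ is the vertical half of the Riordan array $(g(x),xf(x))$.
   Context: All power series are formal power series in $x$ with coefficients in $\mathbb{Q}$. $\mathcal{F}_0$ is the set of series $a_0+a_1x+a_2x^2+\cdots$ with $a_0\neq 0$; $\mathcal{F}_1$ is the set of series $a_1x+a_2x^2+\cdots$ with $a_1\ne 0$. $[x^m]$ extracts the coefficient of $x^m$ (and is $0$ for $m<0$). For $u\in\mathcal{F}_0$, $v\in\mathcal{F}_1$, the Riordan array $(u,v)$ is the infinite lower-triangular matrix, indexed by $n,k\ge0$, with $(n,k)$ entry $[x^n]\,u(x)v(x)^k$. The vertical half of a lower-triangular matrix $(a_{n,k})_{n,k\ge 0}$ is the lower-triangular matrix whose $(n,k)$ entry is $a_{2n-k,n}$ for $0\le k\le n$ (and $0$ for $k>n$). -}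

module Defs where

open import Algebra.Properties.CommutativeMonoid.Sum using (sum)
open import Data.Bool.Base using (if_then_else_)
open import Data.Fin.Base using (toℕ)
open import Data.Integer.Base using (ℤ; +_; -[1+_])
open import Data.Nat.Base as ℕ using (ℕ; zero; suc; _∸_)
open import Data.Nat.Properties using (_≤?_)
open import Data.Product.Base using (Σ-syntax)
open import Data.Rational.Base as ℚ using (ℚ; 0ℚ; 1ℚ)
open import Data.Rational.Properties as ℚₚ using (+-0-commutativeMonoid)
open import Relation.Binary.PropositionalEquality
  using (_≡_; _≢_; sym; trans; cong₂)
open import Relation.Nullary.Decidable.Core using (⌊_⌋)

infixl 7 _*_
infixr 8 _^_
infix  4 _≐_

-- Formal power series over ℚ, as coefficient sequences.  Equality of series
-- is pointwise equality of coefficients.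
PowerSeries : Set
PowerSeries = ℕ → ℚ

𝟙 : PowerSeries
𝟙 zero    = 1ℚ
𝟙 (suc _) = 0ℚ

X : PowerSeries
X zero          = 0ℚ
X (suc zero)    = 1ℚ
X (suc (suc _)) = 0ℚ

_*_ : PowerSeries → PowerSeries → PowerSeries
(a * b) n = sum +-0-commutativeMonoid {suc n} λ i → a (toℕ i) ℚ.* b (n ∸ toℕ i)

_^_ : PowerSeries → ℕ → PowerSeries
a ^ zero  = 𝟙
a ^ suc n = a * a ^ n

[x^_] : ℤ → PowerSeries → ℚ
[x^ + m ]      a = a m
[x^ -[1+ _ ] ] a = 0ℚ

record 𝓕₀ : Set where
  field
    series   : PowerSeries
    coeff₀≢0 : series 0 ≢ 0ℚ

record 𝓕₁ : Set where
  field
    series   : PowerSeries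
    coeff₀≡0 : series 0 ≡ 0ℚ
    coeff₁≢0 : series 1 ≢ 0ℚ

X· : 𝓕₀ → 𝓕₁
X· f = record
  { series   = X * f.series
  ; coeff₀≡0 = trans (ℚₚ.+-identityʳ _) (ℚₚ.*-zeroˡ (f.series 0))
  ; coeff₁≢0 = λ eq → f.coeff₀≢0 (trans (sym coeff₁) eq)
  }
  where
  module f = 𝓕₀ f
  coeff₁ : (X * f.series) 1 ≡ f.series 0
  coeff₁ = trans
    (cong₂ ℚ._+_ (ℚₚ.*-zeroˡ (f.series 1))
      (trans (ℚₚ.+-identityʳ _) (ℚₚ.*-identityˡ (f.series 0))))
    (ℚₚ.+-identityˡ (f.series 0))

-- Infinite matrices, row index first.
Matrix : Set
Matrix = ℕ → ℕ → ℚ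

_≐_ : Matrix → Matrix → Set
A ≐ B = ∀ n k → A n k ≡ B n k

riordan : 𝓕₀ → 𝓕₁ → Matrix
riordan u v n k = [x^ + n ] (𝓕₀.series u * 𝓕₁.series v ^ k)

IsRiordan : Matrix → Set
IsRiordan A = Σ[ u ∈ 𝓕₀ ] Σ[ v ∈ 𝓕₁ ] A ≐ riordan u v

-- The subtraction is never truncated, since it is only reached when k ≤ n.
verticalHalf : Matrix → Matrix
verticalHalf A n k = if ⌊ k ≤? n ⌋ then A (2 ℕ.* n ∸ k) n else 0ℚ

{-# OPTIONS --safe #-}

-- Since t(n+1, k+1) = [x^(n-k)] f · (g fⁿ), the array t obeys the recurrence
-- t(n+1, k+1) = Σ_j f_j t(n, k+j): f is its A-sequence.  If v solves
-- v = x f(v), then u v^(k+1) = x Σ_j f_j u v^(k+j), so riordan u v obeys the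
-- same recurrence for every u.  Together with column 0 the recurrence
-- determines a lower-triangular array, so it suffices to let u be column 0
-- of t.  The vertical half is a shift: [x^(m+n)] g (x f)ⁿ = [x^m] g fⁿ.
module Submission where

open import Defs
open import Algebra.Bundles using (CommutativeRing)
open import Algebra.Properties.CommutativeMonoid.Sum using (sum; ∑-distrib-+)
open import Data.Fin.Base using (toℕ)
open import Data.Integer.Base using (+_; _-_)
open import Data.Integer.Properties using (⊖-≥; m-n≡m⊖n; [1+m]⊖[1+n]≡m⊖n)
open import Data.Nat.Base as ℕ using (ℕ; zero; suc; _∸_; _≤_; _<_; z≤n; s≤s)
open import Data.Nat.Properties as ℕₚ using (_≤?_)
open import Data.Product.Base using (_×_; _,_)
open import Data.Rational.Base as ℚ using (ℚ; 0ℚ)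
open import Data.Rational.Properties as ℚₚ using (+-0-commutativeMonoid)
open import Function.Base using (_∘_)
open import Relation.Binary.PropositionalEquality
open import Relation.Nullary.Decidable.Core using (yes; no)
open import Algebra.Properties.Semiring.Sum
  (CommutativeRing.semiring ℚₚ.+-*-commutativeRing) using (*-distribˡ-sum)

open ≡-Reasoning

-- Finite sums over initial segments

-- The summand lives on ℕ, so sums of different lengths can share it; `(a * b) n` is definitionally
-- such a sum of length `suc n`.
∑< : ℕ → (ℕ → ℚ) → ℚ
∑< n h = sum +-0-commutativeMonoid {n} (h ∘ toℕ)

∑<-cong : ∀ n {h h′ : ℕ → ℚ} → (∀ j → j < n → h j ≡ h′ j) → ∑< n h ≡ ∑< n h′
∑<-cong zero    eq = refl
∑<-cong (suc n) eq =
  cong₂ ℚ._+_ (eq 0 (s≤s z≤n)) (∑<-cong n λ j j<n → eq (suc j) (s≤s j<n))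

∑<-zero : ∀ n {h : ℕ → ℚ} → (∀ j → h j ≡ 0ℚ) → ∑< n h ≡ 0ℚ
∑<-zero zero    h≡0 = refl
∑<-zero (suc n) h≡0 =
  trans (cong₂ ℚ._+_ (h≡0 0) (∑<-zero n (h≡0 ∘ suc))) (ℚₚ.+-identityˡ 0ℚ)

∑<-extend : ∀ {m n} {h : ℕ → ℚ} → m ≤ n → (∀ j → m ≤ j → h j ≡ 0ℚ) →
            ∑< m h ≡ ∑< n h
∑<-extend {n = n} z≤n h≡0 = sym (∑<-zero n λ j → h≡0 j z≤n)
∑<-extend {h = h} (s≤s m≤n) h≡0 =
  cong (h 0 ℚ.+_) (∑<-extend m≤n λ j m≤j → h≡0 (suc j) (s≤s m≤j))

-- Algebra of the Cauchy product

-- `(a * b) (suc n)` unfolds definitionally to `a 0 ℚ.* b (suc n) ℚ.+ (tail a * b) n`, which drives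
-- the inductions on the degree.
tail : PowerSeries → PowerSeries
tail a n = a (suc n)

*-cong-≤ : ∀ {a a′ b b′ : PowerSeries} n →
           (∀ i → i ≤ n → a i ≡ a′ i) → (∀ i → i ≤ n → b i ≡ b′ i) →
           (a * b) n ≡ (a′ * b′) n
*-cong-≤ n eqa eqb = ∑<-cong (suc n) λ { i (s≤s i≤n) →
  cong₂ ℚ._*_ (eqa i i≤n) (eqb (n ∸ i) (ℕₚ.m∸n≤m n i)) }

*-congˡ : ∀ (a : PowerSeries) {b b′ : PowerSeries} → b ≗ b′ → a * b ≗ a * b′
*-congˡ a eq n = *-cong-≤ {a} n (λ _ _ → refl) (λ i _ → eq i)

*-congʳ : ∀ {a a′ : PowerSeries} (b : PowerSeries) → a ≗ a′ → a * b ≗ a′ * b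
*-congʳ b eq n = *-cong-≤ {b = b} n (λ i _ → eq i) (λ _ _ → refl)

*-zeroˡ : ∀ b → (λ _ → 0ℚ) * b ≗ λ _ → 0ℚ
*-zeroˡ b n = ∑<-zero (suc n) λ i → ℚₚ.*-zeroˡ (b (n ∸ i))

*-zeroʳ-≤ : ∀ a {b} n → (∀ i → i ≤ n → b i ≡ 0ℚ) → (a * b) n ≡ 0ℚ
*-zeroʳ-≤ a n b≡0 = trans (*-cong-≤ {a} n (λ _ _ → refl) b≡0)
  (∑<-zero (suc n) λ i → ℚₚ.*-zeroʳ (a i))

-- Both `tail (a * b)` and a finite linear combination with its first term split off have the shape
-- of this left factor.
*-linearˡ : ∀ p (a a′ b : PowerSeries) →
            (λ i → p ℚ.* a i ℚ.+ a′ i) * b ≗ λ n → p ℚ.* (a * b) n ℚ.+ (a′ * b) n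
*-linearˡ p a a′ b n = begin
  ∑< (suc n) (λ i → (p ℚ.* a i ℚ.+ a′ i) ℚ.* b (n ∸ i))
    ≡⟨ ∑<-cong (suc n) (λ i _ → trans
         (ℚₚ.*-distribʳ-+ (b (n ∸ i)) (p ℚ.* a i) (a′ i))
         (cong (ℚ._+ a′ i ℚ.* b (n ∸ i)) (ℚₚ.*-assoc p (a i) (b (n ∸ i))))) ⟩
  ∑< (suc n) (λ i → p ℚ.* (a i ℚ.* b (n ∸ i)) ℚ.+ a′ i ℚ.* b (n ∸ i))
    ≡⟨ ∑-distrib-+ +-0-commutativeMonoid {suc n}
         (λ i → p ℚ.* (a (toℕ i) ℚ.* b (n ∸ toℕ i))) (λ i → a′ (toℕ i) ℚ.* b (n ∸ toℕ i)) ⟩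
  ∑< (suc n) (λ i → p ℚ.* (a i ℚ.* b (n ∸ i))) ℚ.+ (a′ * b) n
    ≡⟨ cong (ℚ._+ (a′ * b) n) 
         (*-distribˡ-sum {suc n} p λ i → a (toℕ i) ℚ.* b (n ∸ toℕ i)) ⟨
  p ℚ.* (a * b) n ℚ.+ (a′ * b) n ∎

*-∑<ˡ : ∀ N (c : PowerSeries) (a : ℕ → PowerSeries) b →
        (λ i → ∑< N λ j → c j ℚ.* a j i) * b ≗ λ n → ∑< N λ j → c j ℚ.* (a j * b) n
*-∑<ˡ zero    c a b n = *-zeroˡ b n
*-∑<ˡ (suc N) c a b n = trans
  (*-linearˡ (c 0) (a 0) (λ i → ∑< N λ j → c (suc j) ℚ.* a (suc j) i) b n)
  (cong (c 0 ℚ.* (a 0 * b) n ℚ.+_) (*-∑<ˡ N (c ∘ suc) (a ∘ suc) b n))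

*-assoc : ∀ a b c → (a * b) * c ≗ a * (b * c)
*-assoc a b c zero = begin
  (a 0 ℚ.* b 0 ℚ.+ 0ℚ) ℚ.* c 0 ℚ.+ 0ℚ
    ≡⟨ cong (λ x → x ℚ.* c 0 ℚ.+ 0ℚ) (ℚₚ.+-identityʳ (a 0 ℚ.* b 0)) ⟩
  (a 0 ℚ.* b 0) ℚ.* c 0 ℚ.+ 0ℚ
    ≡⟨ cong (ℚ._+ 0ℚ) (ℚₚ.*-assoc (a 0) (b 0) (c 0)) ⟩
  a 0 ℚ.* (b 0 ℚ.* c 0) ℚ.+ 0ℚ
    ≡⟨ cong (λ x → a 0 ℚ.* x ℚ.+ 0ℚ) (ℚₚ.+-identityʳ (b 0 ℚ.* c 0)) ⟨
  a 0 ℚ.* (b 0 ℚ.* c 0 ℚ.+ 0ℚ) ℚ.+ 0ℚ ∎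
*-assoc a b c (suc n) = begin
  (a 0 ℚ.* b 0 ℚ.+ 0ℚ) ℚ.* c (suc n) ℚ.+ (tail (a * b) * c) n
    ≡⟨ cong₂ ℚ._+_
         (trans (cong (ℚ._* c (suc n)) (ℚₚ.+-identityʳ (a 0 ℚ.* b 0)))
                (ℚₚ.*-assoc (a 0) (b 0) (c (suc n))))
         (trans (*-linearˡ (a 0) (tail b) (tail a * b) c n)
                (cong (a 0 ℚ.* (tail b * c) n ℚ.+_) (*-assoc (tail a) b c n))) ⟩
  a 0 ℚ.* (b 0 ℚ.* c (suc n)) ℚ.+ (a 0 ℚ.* (tail b * c) n ℚ.+ (tail a * (b * c)) n)
    ≡⟨ ℚₚ.+-assoc (a 0 ℚ.* (b 0 ℚ.* c (suc n))) (a 0 ℚ.* (tail b * c) n) _ ⟨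
  (a 0 ℚ.* (b 0 ℚ.* c (suc n)) ℚ.+ a 0 ℚ.* (tail b * c) n) ℚ.+ (tail a * (b * c)) n
    ≡⟨ cong (ℚ._+ (tail a * (b * c)) n)
         (ℚₚ.*-distribˡ-+ (a 0) (b 0 ℚ.* c (suc n)) ((tail b * c) n)) ⟨
  a 0 ℚ.* (b * c) (suc n) ℚ.+ (tail a * (b * c)) n ∎

-- Splits off the last term, mirroring the definitional split of the first one; commutativity
-- exchanges the two.
*-sucʳ : ∀ a b n → (a * b) (suc n) ≡ (a * tail b) n ℚ.+ a (suc n) ℚ.* b 0
*-sucʳ a b zero    = begin
  a 0 ℚ.* b 1 ℚ.+ (a 1 ℚ.* b 0 ℚ.+ 0ℚ)
    ≡⟨ cong (a 0 ℚ.* b 1 ℚ.+_) (ℚₚ.+-comm (a 1 ℚ.* b 0) 0ℚ) ⟩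
  a 0 ℚ.* b 1 ℚ.+ (0ℚ ℚ.+ a 1 ℚ.* b 0)
    ≡⟨ ℚₚ.+-assoc (a 0 ℚ.* b 1) 0ℚ (a 1 ℚ.* b 0) ⟨
  (a 0 ℚ.* b 1 ℚ.+ 0ℚ) ℚ.+ a 1 ℚ.* b 0 ∎
*-sucʳ a b (suc n) = trans
  (cong (a 0 ℚ.* b (suc (suc n)) ℚ.+_) (*-sucʳ (tail a) b n))
  (sym (ℚₚ.+-assoc (a 0 ℚ.* b (suc (suc n))) ((tail a * tail b) n)
                   (a (suc (suc n)) ℚ.* b 0)))

*-comm : ∀ a b → a * b ≗ b * a
*-comm a b zero    = cong (ℚ._+ 0ℚ) (ℚₚ.*-comm (a 0) (b 0))
*-comm a b (suc n) = begin
  a 0 ℚ.* b (suc n) ℚ.+ (tail a * b) n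
    ≡⟨ cong₂ ℚ._+_ (ℚₚ.*-comm (a 0) (b (suc n))) (*-comm (tail a) b n) ⟩
  b (suc n) ℚ.* a 0 ℚ.+ (b * tail a) n
    ≡⟨ ℚₚ.+-comm (b (suc n) ℚ.* a 0) ((b * tail a) n) ⟩
  (b * tail a) n ℚ.+ b (suc n) ℚ.* a 0
    ≡⟨ *-sucʳ b a n ⟨
  (b * a) (suc n) ∎

x∙yz≗y∙xz : ∀ a b c → a * (b * c) ≗ b * (a * c)
x∙yz≗y∙xz a b c n = begin
  (a * (b * c)) n  ≡⟨ *-assoc a b c n ⟨
  ((a * b) * c) n  ≡⟨ *-congʳ c (*-comm a b) n ⟩
  ((b * a) * c) n  ≡⟨ *-assoc b a c n ⟩
  (b * (a * c)) n  ∎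

*-identityˡ : ∀ a → 𝟙 * a ≗ a
*-identityˡ a zero    = trans (ℚₚ.+-identityʳ _) (ℚₚ.*-identityˡ (a 0))
*-identityˡ a (suc n) = trans
  (cong₂ ℚ._+_ (ℚₚ.*-identityˡ (a (suc n))) (*-zeroˡ a n))
  (ℚₚ.+-identityʳ (a (suc n)))

*-identityʳ : ∀ a → a * 𝟙 ≗ a
*-identityʳ a n = trans (*-comm a 𝟙 n) (*-identityˡ a n)

*-suc-ord₁ : ∀ {a} b n → a 0 ≡ 0ℚ → (a * b) (suc n) ≡ (tail a * b) n
*-suc-ord₁ {a} b n a₀≡0 = trans
  (cong (ℚ._+ (tail a * b) n)
    (trans (cong (ℚ._* b (suc n)) a₀≡0) (ℚₚ.*-zeroˡ (b (suc n)))))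
  (ℚₚ.+-identityˡ ((tail a * b) n))

-- Powers, order and composition

^-distribˡ-+-* : ∀ a m n → a ^ (m ℕ.+ n) ≗ a ^ m * a ^ n
^-distribˡ-+-* a zero    n i = sym (*-identityˡ (a ^ n) i)
^-distribˡ-+-* a (suc m) n i = trans (*-congˡ a (^-distribˡ-+-* a m n) i)
  (sym (*-assoc a (a ^ m) (a ^ n) i))

^-cong-≤ : ∀ {a a′ : PowerSeries} n j →
           (∀ i → i ≤ n → a i ≡ a′ i) → ∀ i → i ≤ n → (a ^ j) i ≡ (a′ ^ j) i
^-cong-≤ n zero    eq i i≤n = refl
^-cong-≤ n (suc j) eq i i≤n = *-cong-≤ i
  (λ l l≤i → eq l (ℕₚ.≤-trans l≤i i≤n))
  (λ l l≤i → ^-cong-≤ n j eq l (ℕₚ.≤-trans l≤i i≤n))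

-- Each factor `v` lacks a constant term and so raises the order by at least one.
^-ord : ∀ {v} → v 0 ≡ 0ℚ → ∀ {n j} → n < j → (v ^ j) n ≡ 0ℚ
^-ord {v} v₀≡0 {zero} {suc j} _ = trans (ℚₚ.+-identityʳ _)
  (trans (cong (ℚ._* (v ^ j) 0) v₀≡0) (ℚₚ.*-zeroˡ ((v ^ j) 0)))
^-ord {v} v₀≡0 {suc n} {suc j} (s≤s n<j) = trans (*-suc-ord₁ {v} (v ^ j) n v₀≡0)
  (*-zeroʳ-≤ (tail v) n λ i i≤n → ^-ord {v} v₀≡0 (ℕₚ.≤-<-trans i≤n n<j))

-- x f(v) when v 0 ≡ 0ℚ: the terms with j > n vanish, as v ^ j has order ≥ j.
x·_∘ˢ_ : PowerSeries → PowerSeries → PowerSeries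
(x· f ∘ˢ v) zero    = 0ℚ
(x· f ∘ˢ v) (suc n) = ∑< (suc n) λ j → f j ℚ.* (v ^ j) n

-- The factor x gains one degree of agreement: coefficient `suc i` of the result reads `v` only up
-- to degree `i`.
x·∘ˢ-contractive : ∀ f {v w : PowerSeries} n → (∀ i → i ≤ n → v i ≡ w i) →
                   ∀ i → i ≤ suc n → (x· f ∘ˢ v) i ≡ (x· f ∘ˢ w) i
x·∘ˢ-contractive f n eq zero    _         = refl
x·∘ˢ-contractive f n eq (suc i) (s≤s i≤n) =
  ∑<-cong (suc i) λ j _ → cong (f j ℚ.*_) (^-cong-≤ n j eq i i≤n)

-- Solving v = x f(v) by successive approximation

module _ (f : PowerSeries) where

  approx : ℕ → PowerSeries
  approx zero    = λ _ → 0ℚ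
  approx (suc m) = x· f ∘ˢ approx m

  approx-step : ∀ m i → i ≤ m → approx m i ≡ approx (suc m) i
  approx-step zero    .0 z≤n = refl
  approx-step (suc m) i  i≤  = x·∘ˢ-contractive f m (approx-step m) i i≤

  -- The diagonal is the limit of the iterates, since coefficient `n` no longer changes from iterate
  -- `n` on.
  fixpoint : PowerSeries
  fixpoint n = approx n n

  approx-stable : ∀ k i → approx i i ≡ approx (k ℕ.+ i) i
  approx-stable zero    i = refl
  approx-stable (suc k) i =
    trans (approx-stable k i) (approx-step (k ℕ.+ i) i (ℕₚ.m≤n+m i k))

  fixpoint≗approx : ∀ n i → i ≤ n → fixpoint i ≡ approx n i
  fixpoint≗approx n i i≤n =
    trans (approx-stable (n ∸ i) i) (cong (λ m → approx m i) (ℕₚ.m∸n+n≡m i≤n))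

  fixpoint-eq : fixpoint ≗ x· f ∘ˢ fixpoint
  fixpoint-eq zero    = refl
  -- `fixpoint (suc n)` unfolds to `(x· f ∘ˢ approx n) (suc n)`, and `approx n` agrees with
  -- `fixpoint` up to degree `n`.
  fixpoint-eq (suc n) = sym
    (x·∘ˢ-contractive f n (fixpoint≗approx n) (suc n) ℕₚ.≤-refl)

  -- The length of the sum is independent of `i`, so up to degree `n` the tail is one fixed linear
  -- combination of powers.
  tail-fixpoint : ∀ {n i} → i ≤ n →
                  fixpoint (suc i) ≡ ∑< (suc n) λ j → f j ℚ.* (fixpoint ^ j) i
  tail-fixpoint {n} {i} i≤n = trans (fixpoint-eq (suc i))
    (∑<-extend (s≤s i≤n) λ j i<j →
      trans (cong (f j ℚ.*_) (^-ord {fixpoint} refl i<j)) (ℚₚ.*-zeroʳ (f j)))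

-- Arrays with a given A-sequence

-- Stopping at j = n loses nothing for a lower-triangular `A`, whose entries `A n (k ℕ.+ j)` vanish
-- for j > n.
IsASequence : PowerSeries → Matrix → Set
IsASequence f A = ∀ n k → A (suc n) (suc k) ≡ ∑< (suc n) λ j → f j ℚ.* A n (k ℕ.+ j)

-- Row `n` fixes row `suc n` outside column 0. The recurrence does not produce row 0, so it is
-- compared separately.
ASequence-unique : ∀ {f A B} → IsASequence f A → IsASequence f B →
                   (∀ n → A n 0 ≡ B n 0) → (∀ k → A 0 (suc k) ≡ B 0 (suc k)) → A ≐ B
ASequence-unique stepA stepB col₀ row₀ n zero = col₀ n
ASequence-unique stepA stepB col₀ row₀ zero (suc k) = row₀ k
ASequence-unique {f} {A} {B} stepA stepB col₀ row₀ (suc n) (suc k) = trans (stepA n k) (trans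
  (∑<-cong (suc n) λ j _ → cong (f j ℚ.*_)
    (ASequence-unique {f} {A} {B} stepA stepB col₀ row₀ n (k ℕ.+ j)))
  (sym (stepB n k)))

riordan-fixpoint-isASequence : ∀ f u → IsASequence f λ n k → (u * fixpoint f ^ k) n
riordan-fixpoint-isASequence f u n k = begin
  (u * (v * v ^ k)) (suc n)
    -- One factor `v` moves to the front, where its factor x is cancelled against the degree and its
    -- tail expanded in powers of `v`.
    ≡⟨ x∙yz≗y∙xz u v (v ^ k) (suc n) ⟩
  (v * (u * v ^ k)) (suc n)
    ≡⟨ *-suc-ord₁ {v} (u * v ^ k) n refl ⟩
  (tail v * (u * v ^ k)) n
    ≡⟨ *-cong-≤ {b = u * v ^ k} n (λ i → tail-fixpoint f) (λ _ _ → refl) ⟩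
  ((λ i → ∑< (suc n) λ j → f j ℚ.* (v ^ j) i) * (u * v ^ k)) n
    ≡⟨ *-∑<ˡ (suc n) f (v ^_) (u * v ^ k) n ⟩
  (∑< (suc n) λ j → f j ℚ.* (v ^ j * (u * v ^ k)) n)
    ≡⟨ ∑<-cong (suc n) (λ j _ → cong (f j ℚ.*_) (powers j)) ⟩
  (∑< (suc n) λ j → f j ℚ.* (u * v ^ (k ℕ.+ j)) n) ∎
  where
  v = fixpoint f
  powers : ∀ j → (v ^ j * (u * v ^ k)) n ≡ (u * v ^ (k ℕ.+ j)) n
  powers j = begin
    (v ^ j * (u * v ^ k)) n  ≡⟨ x∙yz≗y∙xz (v ^ j) u (v ^ k) n ⟩
    (u * (v ^ j * v ^ k)) n  ≡⟨ *-congˡ u (*-comm (v ^ j) (v ^ k)) n ⟩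
    (u * (v ^ k * v ^ j)) n  ≡⟨ *-congˡ u (^-distribˡ-+-* v k j) n ⟨
    (u * v ^ (k ℕ.+ j)) n    ∎

-- The array t and its A-sequence

[x^n-k]-≤ : ∀ {n k} a → k ≤ n → [x^ (+ n - + k) ] a ≡ a (n ∸ k)
[x^n-k]-≤ {n} {k} a k≤n =
  cong (λ m → [x^ m ] a) (trans (m-n≡m⊖n n k) (⊖-≥ k≤n))

[x^n-k]-> : ∀ {n k} a → n < k → [x^ (+ n - + k) ] a ≡ 0ℚ
[x^n-k]-> {zero}  {suc k} a _         = refl
[x^n-k]-> {suc n} {suc k} a (s≤s n<k) = trans
  (cong (λ m → [x^ m ] a) (trans ([1+m]⊖[1+n]≡m⊖n n k) (sym (m-n≡m⊖n n k))))
  ([x^n-k]-> a n<k)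

[x^n-k]g*f^n : PowerSeries → PowerSeries → Matrix
[x^n-k]g*f^n g f n k = [x^ (+ n - + k) ] (g * f ^ n)

[x^n-k]g*f^n-isASequence : ∀ g f → IsASequence f ([x^n-k]g*f^n g f)
[x^n-k]g*f^n-isASequence g f n k with k ≤? n
... | yes k≤n = begin
  t (suc n) (suc k)
    ≡⟨ [x^n-k]-≤ (g * f ^ suc n) (s≤s k≤n) ⟩
  (g * (f * f ^ n)) (n ∸ k)
    -- With one `f` in front, the product unfolds to the sum displayed next.
    ≡⟨ x∙yz≗y∙xz g f (f ^ n) (n ∸ k) ⟩
  (∑< (suc (n ∸ k)) λ j → f j ℚ.* (g * f ^ n) (n ∸ k ∸ j))
    ≡⟨ ∑<-cong (suc (n ∸ k)) (λ { j (s≤s j≤n∸k) → cong (f j ℚ.*_) (entry j j≤n∸k) }) ⟩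
  (∑< (suc (n ∸ k)) λ j → f j ℚ.* t n (k ℕ.+ j))
    -- The added terms have k + j > n, hence a negative exponent in `t n (k ℕ.+ j)`.
    ≡⟨ ∑<-extend (s≤s (ℕₚ.m∸n≤m n k)) (λ j n∸k<j → vanish j 
         (subst (_< k ℕ.+ j) (ℕₚ.m+[n∸m]≡n k≤n) (ℕₚ.+-monoʳ-< k n∸k<j))) ⟩
  (∑< (suc n) λ j → f j ℚ.* t n (k ℕ.+ j)) ∎
  where
  t = [x^n-k]g*f^n g f
  entry : ∀ j → j ≤ n ∸ k → (g * f ^ n) (n ∸ k ∸ j) ≡ t n (k ℕ.+ j)
  entry j j≤n∸k = trans
    (cong (g * f ^ n) (ℕₚ.∸-+-assoc n k j))
    (sym ([x^n-k]-≤ (g * f ^ n)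
      (subst (k ℕ.+ j ≤_) (ℕₚ.m+[n∸m]≡n k≤n) (ℕₚ.+-monoʳ-≤ k j≤n∸k))))
  vanish : ∀ j → n < k ℕ.+ j → f j ℚ.* t n (k ℕ.+ j) ≡ 0ℚ
  vanish j n<k+j = trans (cong (f j ℚ.*_) ([x^n-k]-> (g * f ^ n) n<k+j)) (ℚₚ.*-zeroʳ (f j))
-- For k > n every exponent on either side is negative.
... | no k≰n = trans ([x^n-k]-> (g * f ^ suc n) (s≤s (ℕₚ.≰⇒> k≰n)))
  (sym (∑<-zero (suc n) λ j → trans
    (cong (f j ℚ.*_) ([x^n-k]-> (g * f ^ n) (ℕₚ.m≤n⇒m≤n+o j (ℕₚ.≰⇒> k≰n))))
    (ℚₚ.*-zeroʳ (f j))))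

-- The degree shift and the vertical half

-- Each factor `X` lowers the degree to be read by one; the `f` left behind is absorbed into `a`, so
-- `a` varies in the induction.
*-[X*]^ : ∀ a f n m → (a * (X * f) ^ n) (m ℕ.+ n) ≡ (a * f ^ n) m
*-[X*]^ a f zero    m = cong (a * 𝟙) (ℕₚ.+-identityʳ m)
*-[X*]^ a f (suc n) m = begin
  (a * (X * f * P)) (m ℕ.+ suc n)     ≡⟨ cong (a * (X * f * P)) (ℕₚ.+-suc m n) ⟩
  (a * (X * f * P)) (suc (m ℕ.+ n))   ≡⟨ x∙yz≗y∙xz a (X * f) P (suc (m ℕ.+ n)) ⟩
  (X * f * (a * P)) (suc (m ℕ.+ n))   ≡⟨ *-assoc X f (a * P) (suc (m ℕ.+ n)) ⟩
  (X * (f * (a * P))) (suc (m ℕ.+ n)) ≡⟨ *-suc-ord₁ {X} (f * (a * P)) (m ℕ.+ n) refl ⟩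
  (tail X * (f * (a * P))) (m ℕ.+ n)  ≡⟨ *-congʳ (f * (a * P)) tail-X (m ℕ.+ n) ⟩
  (𝟙 * (f * (a * P))) (m ℕ.+ n)       ≡⟨ *-identityˡ (f * (a * P)) (m ℕ.+ n) ⟩
  (f * (a * P)) (m ℕ.+ n)             ≡⟨ *-assoc f a P (m ℕ.+ n) ⟨
  (f * a * P) (m ℕ.+ n)               ≡⟨ *-[X*]^ (f * a) f n m ⟩
  (f * a * f ^ n) m                   ≡⟨ *-assoc f a (f ^ n) m ⟩
  (f * (a * f ^ n)) m                 ≡⟨ x∙yz≗y∙xz f a (f ^ n) m ⟩
  (a * (f * f ^ n)) m                 ∎
  where
  P = (X * f) ^ n
  tail-X : tail X ≗ 𝟙
  tail-X zero    = refl
  tail-X (suc _) = refl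

2*n∸k≡n∸k+n : ∀ {n k} → k ≤ n → 2 ℕ.* n ∸ k ≡ n ∸ k ℕ.+ n
2*n∸k≡n∸k+n {n} {k} k≤n = begin
  n ℕ.+ (n ℕ.+ 0) ∸ k  ≡⟨ cong (λ m → n ℕ.+ m ∸ k) (ℕₚ.+-identityʳ n) ⟩
  n ℕ.+ n ∸ k          ≡⟨ ℕₚ.+-∸-comm n k≤n ⟩
  n ∸ k ℕ.+ n          ∎

proposition8 : (g f : 𝓕₀) →
    let t : Matrix
        t n k = [x^ (+ n - + k) ] (𝓕₀.series g * 𝓕₀.series f ^ n)
    in IsRiordan t × (t ≐ verticalHalf (riordan g (X· f)))
proposition8 g f = (u , v , t≐riordan) , t≐verticalHalf
  where
  module g = 𝓕₀ g
  module f = 𝓕₀ f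

  t : Matrix
  t = [x^n-k]g*f^n g.series f.series

  u : 𝓕₀
  u = record
    { series   = λ n → t n 0
    -- `t 0 0` computes to `(g.series * 𝟙) 0`.
    ; coeff₀≢0 = λ eq → g.coeff₀≢0 (trans (sym (*-identityʳ g.series 0)) eq)
    }

  v : 𝓕₁
  v = record
    { series   = fixpoint f.series
    ; coeff₀≡0 = refl
    -- Coefficient 1 of the fixed point is a one-term sum that computes to `(f.series * 𝟙) 0`.
    ; coeff₁≢0 = λ eq → f.coeff₀≢0 (trans (sym (*-identityʳ f.series 0)) eq)
    }

  t≐riordan : t ≐ riordan u v
  t≐riordan = ASequence-unique {f.series} {t} {riordan u v}
    ([x^n-k]g*f^n-isASequence g.series f.series)
    (riordan-fixpoint-isASequence f.series (𝓕₀.series u))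
    (λ n → sym (*-identityʳ (𝓕₀.series u) n))
    -- In row 0, a positive power of the fixed point has no constant term.
    (λ k → sym (*-zeroʳ-≤ (𝓕₀.series u) {fixpoint f.series ^ suc k} 0 λ i i≤0 →
      ^-ord {fixpoint f.series} refl {j = suc k} (s≤s (ℕₚ.≤-trans i≤0 z≤n))))

  t≐verticalHalf : t ≐ verticalHalf (riordan g (X· f))
  t≐verticalHalf n k with k ≤? n
  ... | yes k≤n = begin
    t n k
      ≡⟨ [x^n-k]-≤ (g.series * f.series ^ n) k≤n ⟩
    (g.series * f.series ^ n) (n ∸ k)
      ≡⟨ *-[X*]^ g.series f.series n (n ∸ k) ⟨
    riordan g (X· f) (n ∸ k ℕ.+ n) n
      ≡⟨ cong (λ m → riordan g (X· f) m n) (2*n∸k≡n∸k+n k≤n) ⟨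
    riordan g (X· f) (2 ℕ.* n ∸ k) n ∎
  ... | no k≰n = [x^n-k]-> (g.series * f.series ^ n) (ℕₚ.≰⇒> k≰n)
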